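{- Let $\mathrm{Sud}_n$ denote the generalized Sudoku graph. As $n\to\infty$, \[ \overline{\mathrm{scs}}(\mathrm{Sud}_n)=n^4-\Omega(n^{10/3}); \] that is, there exist a constant $C>0$ and an integer $n_0$ such that $\overline{\mathrm{scs}}(\mathrm{Sud}_n)\le n^4-C\,n^{10/3}$ for all integers $n\ge n_0$.
   Context: $\mathrm{Sud}_n$ is the graph $(K_{n^2}\,\Box\,K_{n^2})\cup(nK_n\boxtimes nK_n)$, where $\Box$ is the Cartesian product, $\boxtimes$ the strong product, and the union is a union of edge sets on the common vertex set $[n^2]\times[n^2]$. Here $nK_n$ is the disjoint union of $n$ cliques on the blocks of $n$ consecutive elements of $[n^2]$. Explicitly, two distinct vertices $(a,b)$ and $(\alpha,\beta)$ are adjacent iff $a=\alpha$, or $b=\beta$, or both $\lceil a/n\rceil=\lceil\alpha/n\rceil$ and $\lceil b/n\rceil=\lceil\beta/n\rceil$. Its chromatic number is $n^2$. $[k]=\{1,\dots,k\}$ and $\chi(G)$ is the chromatic number of a graph $G=(V,E)$. For a proper coloring $c:V\to[\chi(G)]$, a determining set for $(G,c)$ is a set $S\subseteq V$ such that for every proper coloring $c':V\to[\chi(G)]$ of $G$, if $c'|_S=c|_S$ then $c'=c$ on all of $V$. A critical set for $(G,c)$ is a determining set for $(G,c)$ that is minimal under inclusion. Define $\mathrm{scs}(G,c)=\min\{|X| : X \text{ is a critical set for } (G,c)\}$ and $\overline{\mathrm{scs}}(G)=\max_c \mathrm{scs}(G,c)$, where the maximum is over all proper colorings $c:V\to[\chi(G)]$.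 -}

module Defs where

open import Data.Nat.Base using (ℕ; zero; suc; _*_; _^_; _≤_; z≤n; s≤s)
import Data.Nat.Properties as ℕ
import Data.Integer.Base as ℤ
open import Data.Rational.Base as ℚ using (ℚ)
open import Data.Fin.Base using (Fin; remQuot; quotient; finToFun; funToFin)
import Data.Fin.Properties as Fin
open import Data.Fin.Subset using (Subset; _∈_; _⊂_; ∣_∣; ⊤)
open import Data.Fin.Subset.Properties
  using (_∈?_; _⊂?_; anySubset?; ∈⊤; ∣p∣≤n)
open import Data.Fin.Subset.Induction using (⊂-wellFounded)
open import Data.Product.Base using (∃; ∃-syntax; _×_; _,_; proj₁; proj₂)
open import Data.Sum.Base as Sum using (_⊎_)
import Data.Product.Base as Product
open import Function.Base using (id; _∘_)
open import Induction.WellFounded using (Acc; acc)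
open import Relation.Binary.Core using (Rel)
import Relation.Binary.Definitions as B
open import Relation.Binary.PropositionalEquality
  using (_≡_; _≢_; _≗_; refl; sym; trans; subst)
open import Relation.Nullary using (¬_; Dec; yes; no; contradiction)
open import Relation.Nullary.Decidable as Dec
  using (_×-dec_; _⊎-dec_; _→-dec_; ¬?)
open import Relation.Unary using (Pred; Decidable)
open import Level using (0ℓ)

IsLeast IsGreatest : Pred ℕ 0ℓ → ℕ → Set
IsLeast    P k = P k × (∀ j → P j → k ≤ j)
IsGreatest P k = P k × (∀ j → P j → j ≤ k)

least : ∀ {P} → Decidable P → ∀ n → P n → ∃ (IsLeast P)
least P? zero p0 = zero , p0 , λ _ _ → z≤n
least {P} P? (suc n) pn with P? zero
... | yes p0 = zero , p0 , λ _ _ → z≤n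
... | no ¬p0 with k , pk , k≤ ← least (P? ∘ suc) n pn = suc k , pk , lower
  where
  lower : ∀ j → P j → suc k ≤ j
  lower zero    p0 = contradiction p0 ¬p0
  lower (suc j) pj = s≤s (k≤ j pj)

greatest : ∀ {P} → Decidable P → ∃ P → ∀ b → (∀ j → P j → j ≤ b) →
           ∃ (IsGreatest P)
greatest P? (n , pn) zero ≤b with ℕ.n≤0⇒n≡0 (≤b n pn)
... | refl = zero , pn , ≤b
greatest {P} P? ∃P (suc b) ≤b with P? (suc b)
... | yes pb = suc b , pb , ≤b
... | no ¬pb = greatest P? ∃P b λ j pj →
  ℕ.m<1+n⇒m≤n (ℕ.≤∧≢⇒< (≤b j pj) λ { refl → ¬pb pj })

IsLeast-unique : ∀ {P k l} → IsLeast P k → IsLeast P l → k ≡ l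
IsLeast-unique (pk , k≤) (pl , l≤) = ℕ.≤-antisym (k≤ _ pl) (l≤ _ pk)

record Graph : Set₁ where
  field
    order : ℕ
    Adj   : Rel (Fin order) 0ℓ
    adj?  : B.Decidable Adj
    adj-sym    : B.Symmetric Adj
    adj-irrefl : B.Irreflexive _≡_ Adj

  V : Set
  V = Fin order

open Graph using (order; V)

module _ (G : Graph) where
  open Graph G using (Adj)

  Proper : ∀ {k} → (V G → Fin k) → Set
  Proper c = ∀ u v → Adj u v → c u ≢ c v

  Colourable : ℕ → Set
  Colourable k = ∃[ c ] Proper {k} c

-- Decidable quantification over the functions between two finite sets; there
-- is no function extensionality, so the predicate has to respect _≗_.

module _ {m k} {P : Pred (Fin m → Fin k) 0ℓ}
         (resp : ∀ {f g} → f ≗ g → P f → P g) (P? : Decidable P) where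

  anyFun? : Dec (∃ P)
  anyFun? = Dec.map′
    (λ (i , p) → finToFun i , p)
    (λ (f , p) → funToFin f , resp (λ x → sym (Fin.finToFun-funToFin f x)) p)
    (Fin.any? λ i → P? (finToFun i))

  allFun? : Dec (∀ f → P f)
  allFun? = Dec.map′
    (λ all f → resp (Fin.finToFun-funToFin f) (all (funToFin f)))
    (λ all i → all (finToFun i))
    (Fin.all? λ i → P? (finToFun i))

module _ (G : Graph) where
  open Graph G using (adj?; adj-irrefl)

  proper? : ∀ {k} → Decidable (Proper G {k})
  proper? c = Fin.all? λ u → Fin.all? λ v →
    adj? u v →-dec ¬? (c u Fin.≟ c v)

  Proper-resp : ∀ {k} {c d : V G → Fin k} → c ≗ d → Proper G c → Proper G d
  Proper-resp c≗d pc u v uv du≡dv =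
    pc u v uv (trans (c≗d u) (trans du≡dv (sym (c≗d v))))

  -- The three searches (here and below) are abstract so that conversion checking
  -- never unfolds them; the values are pinned down by their IsLeast / IsGreatest
  -- specifications.

  abstract
    leastColourable : ∃ (IsLeast (Colourable G))
    leastColourable = least (λ _ → anyFun? Proper-resp proper?)
      (order G) (id , λ _ _ uv u≡v → adj-irrefl u≡v uv)

  χ : ℕ
  χ = proj₁ leastColourable

  χ-isLeast : IsLeast (Colourable G) χ
  χ-isLeast = proj₂ leastColourable

  Colouring : Set
  Colouring = V G → Fin χ

  Determining : Colouring → Subset (order G) → Set
  Determining c S = ∀ (c′ : Colouring) → Proper G c′ →
    (∀ v → v ∈ S → c′ v ≡ c v) → c′ ≗ c

  Critical : Colouring → Subset (order G) → Set
  Critical c S = Determining c S × (∀ T → T ⊂ S → ¬ Determining c T)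

  CriticalSize : Colouring → ℕ → Set
  CriticalSize c k = ∃[ X ] Critical c X × ∣ X ∣ ≡ k

  determining? : ∀ c → Decidable (Determining c)
  determining? c S = allFun?
    (λ f≗g h pg agree v → trans (sym (f≗g v))
      (h (Proper-resp (sym ∘ f≗g) pg) (λ w w∈S → trans (f≗g w) (agree w w∈S)) v))
    (λ c′ → proper? c′
      →-dec Fin.all? (λ v → v ∈? S →-dec c′ v Fin.≟ c v)
      →-dec Fin.all? (λ v → c′ v Fin.≟ c v))

  critical? : ∀ c → Decidable (Critical c)
  critical? c S = determining? c S ×-dec Dec.map′
    (λ ¬∃ T T⊂S dT → ¬∃ (T , T⊂S , dT))
    (λ min (T , T⊂S , dT) → min T T⊂S dT)
    (¬? (anySubset? λ T → T ⊂? S ×-dec determining? c T))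

  determining⇒∃critical : ∀ c S → Determining c S → ∃ (Critical c)
  determining⇒∃critical c S = go S (⊂-wellFounded S)
    where
    go : ∀ S → Acc _⊂_ S → Determining c S → ∃ (Critical c)
    go S (acc rec) dS with anySubset? (λ T → T ⊂? S ×-dec determining? c T)
    ... | yes (T , T⊂S , dT) = go T (rec T⊂S) dT
    ... | no ¬∃ = S , dS , λ T T⊂S dT → ¬∃ (T , T⊂S , dT)

  abstract
    leastCriticalSize : ∀ c → ∃ (IsLeast (CriticalSize c))
    leastCriticalSize c =
      let X , crit = determining⇒∃critical c ⊤ λ _ _ agree v → agree v ∈⊤
      in least (λ k → anySubset? λ Y → critical? c Y ×-dec (∣ Y ∣ ℕ.≟ k))
               ∣ X ∣ (X , crit , refl)

  scs : Colouring → ℕ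
  scs c = proj₁ (leastCriticalSize c)

  scs-isLeast : ∀ c → IsLeast (CriticalSize c) (scs c)
  scs-isLeast c = proj₂ (leastCriticalSize c)

  ScsValue : ℕ → Set
  ScsValue k = ∃[ c ] Proper G c × scs c ≡ k

  Determining-resp : ∀ {c d} → c ≗ d → ∀ {S} → Determining c S → Determining d S
  Determining-resp c≗d det c′ pc′ agree v = trans
    (det c′ pc′ (λ w w∈S → trans (agree w w∈S) (sym (c≗d w))) v) (c≗d v)

  CriticalSize-resp : ∀ {c d} → c ≗ d → ∀ {k} → CriticalSize c k → CriticalSize d k
  CriticalSize-resp c≗d (X , (det , min) , size) =
    X , (Determining-resp c≗d det
        , λ T T⊂X → min T T⊂X ∘ Determining-resp (sym ∘ c≗d)) , size

  CriticalSize-isLeast-resp : ∀ {c d} → c ≗ d → ∀ k →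
    IsLeast (CriticalSize c) k → IsLeast (CriticalSize d) k
  CriticalSize-isLeast-resp {c} {d} c≗d k (attained , lower) =
    CriticalSize-resp {c} {d} c≗d {k} attained ,
    λ j size → lower j (CriticalSize-resp {d} {c} (sym ∘ c≗d) {j} size)

  scs-cong : ∀ {c d} → c ≗ d → scs c ≡ scs d
  scs-cong {c} {d} c≗d = IsLeast-unique {CriticalSize d}
    (CriticalSize-isLeast-resp {c} {d} c≗d (scs c) (scs-isLeast c))
    (scs-isLeast d)

  scs≤order : ∀ c → scs c ≤ order G
  scs≤order c with X , _ , size ← proj₁ (scs-isLeast c) =
    subst (_≤ order G) size (∣p∣≤n X)

  scsValue? : Decidable ScsValue
  scsValue? k = anyFun? {P = λ c → Proper G c × scs c ≡ k}
    (λ {c} {d} c≗d (pc , eq) →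
      Proper-resp c≗d pc , trans (sym (scs-cong {c} {d} c≗d)) eq)
    (λ c → proper? c ×-dec (scs c ℕ.≟ k))

  ∃ScsValue : ∃ ScsValue
  ∃ScsValue = let c , pc = proj₁ χ-isLeast in scs c , c , pc , refl

  abstract
    greatestScs : ∃ (IsGreatest ScsValue)
    greatestScs = greatest {ScsValue} scsValue? ∃ScsValue (order G)
      λ k (c , _ , eq) → subst (_≤ order G) eq (scs≤order c)

  max-scs : ℕ
  max-scs = proj₁ greatestScs

  max-scs-isGreatest : IsGreatest ScsValue max-scs
  max-scs-isGreatest = proj₂ greatestScs

-- With 0-based indices, quotient n a = ⌊a/n⌋ is the index of the block of n
-- consecutive elements that contains a.
SameBlock : ∀ n → Rel (Fin (n * n)) 0ℓ
SameBlock n a α = quotient {n} n a ≡ quotient {n} n α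

Related : ∀ n → Rel (Fin (n * n) × Fin (n * n)) 0ℓ
Related n (a , b) (α , β) =
  a ≡ α ⊎ b ≡ β ⊎ SameBlock n a α × SameBlock n b β

-- Vertices are pairs, encoded by the bijection remQuot.
cell : ∀ n → Fin ((n * n) * (n * n)) → Fin (n * n) × Fin (n * n)
cell n = remQuot {n * n} (n * n)

Sud : ℕ → Graph
Sud n = record
  { order = (n * n) * (n * n)
  ; Adj   = λ u v → u ≢ v × Related n (cell n u) (cell n v)
  ; adj?  = λ u v → ¬? (u Fin.≟ v) ×-dec related? (cell n u) (cell n v)
  ; adj-sym    = λ (u≢v , r) → u≢v ∘ sym , related-sym r
  ; adj-irrefl = λ u≡v (u≢v , _) → u≢v u≡v
  }
  where
  related? : B.Decidable (Related n)
  related? (a , b) (α , β) = a Fin.≟ α ⊎-dec b Fin.≟ β ⊎-dec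
    (quotient {n} n a Fin.≟ quotient {n} n α ×-dec
     quotient {n} n b Fin.≟ quotient {n} n β)

  related-sym : B.Symmetric (Related n)
  related-sym = Sum.map sym (Sum.map sym (Product.map sym sym))

fromℕ : ℕ → ℚ
fromℕ n = ℤ.+ n ℚ./ 1

cube : ℚ → ℚ
cube x = x ℚ.* x ℚ.* x

-- s ≤ n⁴ − C·n^(10/3), i.e. C·n^(10/3) ≤ n⁴ − s.  Both sides are cubed, which
-- is strictly increasing on the reals, so that only rationals occur.
_≤n⁴-_·n^10/3[n=_] : ℕ → ℚ → ℕ → Set
s ≤n⁴- C ·n^10/3[n= n ] =
  cube C ℚ.* fromℕ (n ^ 10) ℚ.≤ cube (fromℕ (n ^ 4) ℚ.- fromℕ s)

{-# OPTIONS --safe #-}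

-- Every colour occurs in each row, column and block, since Sud n has n² colours.  Choose
-- a random set T of vertices with density 1/q, where 4n² ≤ q³ ≤ 32n², and let X be the set of
-- v ∈ T such that no other colour has all its occurrences in the row, column and block of
-- v inside T.  A vertex of X sees each of the other colours outside T, so it is forced by
-- the complement of X, which is therefore determining.  A colour is lost at v ∈ T with
-- conditional probability q⁻³ if its three occurrences are distinct, and at most q⁻² for
-- the at most 2n colours where they are not.  Hence the expected size of X is at least
-- n⁴/q · (1 − n²/q³ − 2n/q²), which is at least n⁴/2q for n ≥ 32, of order n^(10/3).
module Submission where

open import Defs
open import Data.Nat.Base using (ℕ; _≤_)
open import Data.Rational.Base using (ℚ; 0ℚ; _<_)
open import Data.Product.Base using (Σ-syntax; _×_)

import Algebra.Properties.CommutativeMonoid.Sum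
open import Data.Bool.Base using (if_then_else_)
open import Data.Empty using (⊥-elim)
open import Data.Fin.Base as Fin using (Fin; zero; suc; combine; quotient;
  remainder; toℕ; fromℕ<; punchOut)
import Data.Fin.Properties as Fin
open import Data.Fin.Subset
  using (Subset; inside; outside; _∈_; _∉_; _⊆_; _⊂_; _∪_; ⁅_⁆; ∁; ∣_∣)
open import Data.Fin.Subset.Properties
  using (_∈?_; _⊆?_; _⊂?_; anySubset?; x∈⁅x⁆; x∈⁅y⁆⇒x≡y; ∣⁅x⁆∣≡1; ∪-identityˡ; q⊆p∪q;
         x∈p∪q⁻; x∉p⇒x∈∁p; ∣∁p∣≡n∸∣p∣; ∣p∣≤n; p⊆q⇒∣p∣≤∣q∣)
open import Data.Fin.Subset.Induction using (⊂-wellFounded)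
import Data.Integer.Base as ℤ
import Data.Integer.Properties as ℤ
import Data.Nat.Coprimality as Coprime
open import Data.Nat.Base as ℕ using (zero; suc; _+_; _*_; _^_; _∸_; z≤n; s≤s; NonZero)
open import Data.Nat.DivMod
  using (_%_; m%n<n; %-distribˡ-+; [m+n]%n≡m%n; m%n%n≡m%n; m<n⇒m%n≡m)
import Data.Nat.Properties as ℕ
open import Data.Nat.Tactic.RingSolver using (solve-∀)
open import Data.Product.Base using (∃-syntax; _,_; proj₁; proj₂; uncurry)
import Data.Product.Properties as Product
open import Data.Rational.Base as ℚ using (mkℚ; *≤*; 1ℚ)
import Data.Rational.Properties as ℚ
open import Data.Sum.Base using (inj₁; inj₂; [_,_]′)
open import Data.Vec.Base using ([]; _∷_; here; there; tabulate)
open import Data.Vec.Properties using (lookup∘tabulate; []=⇒lookup; lookup⇒[]=)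
open import Function.Base using (_∘_)
open import Function.Definitions using (Injective)
open import Induction.WellFounded using (Acc; acc)
open import Relation.Binary.PropositionalEquality
open import Relation.Nullary using (¬_; Dec; yes; no; does; contradiction)
open import Relation.Nullary.Decidable as Dec using (_×-dec_; ¬?; dec-true; toWitness)
open import Relation.Unary using (Pred; Decidable)
open import Level using (0ℓ)

open Graph using (order; V; Adj)

open Algebra.Properties.CommutativeMonoid.Sum ℕ.+-0-commutativeMonoid
  using (sum; sum-syntax; sum-cong-≗; ∑-distrib-+)

private variable
  m n : ℕ
  P : Set

-- Indicators, finite sums and subsets.

indicator : Dec P → ℕ
indicator P? = if does P? then 1 else 0

indicator-yes : (P? : Dec P) → P → 1 ≤ indicator P?
indicator-yes (yes _) _ = s≤s z≤n
indicator-yes (no ¬p) p = contradiction p ¬p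

indicator-no : (P? : Dec P) → ¬ P → indicator P? ≡ 0
indicator-no (yes p) ¬p = contradiction p ¬p
indicator-no (no _)  _  = refl

indicator-≤ : (P? : Dec P) {k : ℕ} → (P → 1 ≤ k) → indicator P? ≤ k
indicator-≤ (yes p) 1≤k = 1≤k p
indicator-≤ (no _)  _   = z≤n

sum-mono-≤ : {f g : Fin m → ℕ} → (∀ i → f i ≤ g i) → sum f ≤ sum g
sum-mono-≤ {zero}  f≤g = z≤n
sum-mono-≤ {suc m} f≤g = ℕ.+-mono-≤ (f≤g zero) (sum-mono-≤ (f≤g ∘ suc))

term≤sum : (f : Fin m → ℕ) (i : Fin m) → f i ≤ sum f
term≤sum f zero    = ℕ.m≤m+n _ _
term≤sum f (suc i) = ℕ.≤-trans (term≤sum (f ∘ suc) i) (ℕ.m≤n+m _ _)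

sum-const : ∀ m k → ∑[ i < m ] k ≡ m * k
sum-const zero    k = refl
sum-const (suc m) k = cong (k +_) (sum-const m k)

sum-*ˡ : ∀ k (f : Fin m → ℕ) → ∑[ i < m ] (k * f i) ≡ k * sum f
sum-*ˡ {zero}  k f = sym (ℕ.*-zeroʳ k)
sum-*ˡ {suc m} k f = trans (cong (k * f zero +_) (sum-*ˡ k (f ∘ suc)))
  (sym (ℕ.*-distribˡ-+ k (f zero) _))

sum-*ʳ : ∀ (f : Fin m → ℕ) k → ∑[ i < m ] (f i * k) ≡ sum f * k
sum-*ʳ {zero}  f k = refl
sum-*ʳ {suc m} f k = trans (cong (f zero * k +_) (sum-*ʳ (f ∘ suc) k))
  (sym (ℕ.*-distribʳ-+ k (f zero) _))

sum-≟ : (i : Fin m) → ∑[ j < m ] indicator (j Fin.≟ i) ≡ 1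
sum-≟ {suc m} zero    = cong suc (trans (sum-const m 0) (ℕ.*-zeroʳ m))
sum-≟ {suc m} (suc i) = sum-≟ i

∣p∣≡sum : (p : Subset m) → ∣ p ∣ ≡ ∑[ i < m ] indicator (i ∈? p)
∣p∣≡sum []            = refl
∣p∣≡sum (inside  ∷ p) = cong suc (∣p∣≡sum p)
∣p∣≡sum (outside ∷ p) = ∣p∣≡sum p

module _ {P : Pred (Fin m) 0ℓ} (P? : Decidable P) where

  comprehension : Subset m
  comprehension = tabulate (does ∘ P?)

  ∈-comprehension⁺ : ∀ {i} → P i → i ∈ comprehension
  ∈-comprehension⁺ {i} pi =
    lookup⇒[]= i _ (trans (lookup∘tabulate _ i) (dec-true (P? i) pi))

  ∈-comprehension⁻ : ∀ {i} → i ∈ comprehension → P i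
  ∈-comprehension⁻ {i} i∈ with P? i | trans (sym (lookup∘tabulate (does ∘ P?) i)) ([]=⇒lookup i∈)
  ... | yes pi | _  = pi
  ... | no _   | ()

∣⁅x⁆∪p∣≡1+∣p∣ : ∀ {x : Fin m} {p} → x ∉ p → ∣ ⁅ x ⁆ ∪ p ∣ ≡ suc ∣ p ∣
∣⁅x⁆∪p∣≡1+∣p∣ {x = zero}  {inside  ∷ p} x∉p = contradiction here x∉p
∣⁅x⁆∪p∣≡1+∣p∣ {x = zero}  {outside ∷ p} x∉p = cong (suc ∘ ∣_∣) (∪-identityˡ p)
∣⁅x⁆∪p∣≡1+∣p∣ {x = suc x} {inside  ∷ p} x∉p = cong suc (∣⁅x⁆∪p∣≡1+∣p∣ (x∉p ∘ there))
∣⁅x⁆∪p∣≡1+∣p∣ {x = suc x} {outside ∷ p} x∉p = ∣⁅x⁆∪p∣≡1+∣p∣ (x∉p ∘ there)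

⁅x⁆∪p⊆q : ∀ {x : Fin m} {p q} → x ∈ q → p ⊆ q → ⁅ x ⁆ ∪ p ⊆ q
⁅x⁆∪p⊆q {x = x} {p} x∈q p⊆q y∈ with x∈p∪q⁻ ⁅ x ⁆ p y∈
... | inj₁ y∈⁅x⁆ = subst (_∈ _) (sym (x∈⁅y⁆⇒x≡y x y∈⁅x⁆)) x∈q
... | inj₂ y∈p   = p⊆q y∈p

x∉⁅y⁆∪p : ∀ {x y : Fin m} {p} → x ≢ y → x ∉ p → x ∉ ⁅ y ⁆ ∪ p
x∉⁅y⁆∪p {y = y} {p} x≢y x∉p x∈ with x∈p∪q⁻ ⁅ y ⁆ p x∈
... | inj₁ x∈⁅y⁆ = x≢y (x∈⁅y⁆⇒x≡y y x∈⁅y⁆)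
... | inj₂ x∈p   = x∉p x∈p

-- Expectation over random subsets, in integers.

-- With q = 1 + q-1, the value W f is q ^ m times the expectation of f at a random
-- subset containing each point independently with probability 1 / q.
module Random (q-1 : ℕ) where

  q : ℕ
  q = suc q-1

  W : (Subset m → ℕ) → ℕ
  W {zero}  f = f []
  W {suc m} f = W (f ∘ (inside ∷_)) + q-1 * W (f ∘ (outside ∷_))

  W-mono-≤ : {f g : Subset m → ℕ} → (∀ T → f T ≤ g T) → W f ≤ W g
  W-mono-≤ {zero}  f≤g = f≤g []
  W-mono-≤ {suc m} f≤g = ℕ.+-mono-≤ (W-mono-≤ (f≤g ∘ (inside ∷_)))
    (ℕ.*-monoʳ-≤ q-1 (W-mono-≤ (f≤g ∘ (outside ∷_))))

  W-0 : ∀ m → W {m} (λ _ → 0) ≡ 0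
  W-0 zero    = refl
  W-0 (suc m) rewrite W-0 m = ℕ.*-zeroʳ q-1

  W-+ : (f g : Subset m → ℕ) → W (λ T → f T + g T) ≡ W f + W g
  W-+ {zero}  f g = refl
  W-+ {suc m} f g
    rewrite W-+ (f ∘ (inside ∷_)) (g ∘ (inside ∷_))
          | W-+ (f ∘ (outside ∷_)) (g ∘ (outside ∷_)) =
    rearrange q-1 (W (f ∘ (inside ∷_))) (W (g ∘ (inside ∷_)))
                  (W (f ∘ (outside ∷_))) (W (g ∘ (outside ∷_)))
    where
    rearrange : ∀ p a b c d → (a + b) + p * (c + d) ≡ (a + p * c) + (b + p * d)
    rearrange = solve-∀

  W-sum : ∀ {k} (f : Fin k → Subset m → ℕ) →
          W (λ T → ∑[ i < k ] f i T) ≡ ∑[ i < k ] W (f i)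
  W-sum {m} {zero}  f = W-0 m
  W-sum {m} {suc k} f = trans (W-+ (f zero) _) (cong (W (f zero) +_) (W-sum (f ∘ suc)))

  -- First moment method: the two branches carry weights 1 and `q-1`, adding up to `q`, so at each
  -- point the branch with the larger value can be followed.
  W-max : (f : Subset m → ℕ) → ∃[ T ] W f ≤ q ^ m * f T
  W-max {zero}  f = [] , ℕ.m≤m+n _ _
  W-max {suc m} f with W-max (f ∘ (inside ∷_)) | W-max (f ∘ (outside ∷_))
  ... | T₁ , ≤₁ | T₂ , ≤₂ with ℕ.≤-total (f (inside ∷ T₁)) (f (outside ∷ T₂))
  ...   | inj₁ f₁≤f₂ = outside ∷ T₂ , (begin
    W (f ∘ (inside ∷_)) + q-1 * W (f ∘ (outside ∷_))
      ≤⟨ ℕ.+-mono-≤ (ℕ.≤-trans ≤₁ (ℕ.*-monoʳ-≤ (q ^ m) f₁≤f₂)) (ℕ.*-monoʳ-≤ q-1 ≤₂) ⟩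
    q * (q ^ m * f (outside ∷ T₂))  ≡⟨ ℕ.*-assoc q (q ^ m) _ ⟨
    q * q ^ m * f (outside ∷ T₂)    ∎)
    where open ℕ.≤-Reasoning
  ...   | inj₂ f₂≤f₁ = inside ∷ T₁ , (begin
    W (f ∘ (inside ∷_)) + q-1 * W (f ∘ (outside ∷_))
      ≤⟨ ℕ.+-mono-≤ ≤₁ (ℕ.*-monoʳ-≤ q-1 (ℕ.≤-trans ≤₂ (ℕ.*-monoʳ-≤ (q ^ m) f₂≤f₁))) ⟩
    q * (q ^ m * f (inside ∷ T₁))  ≡⟨ ℕ.*-assoc q (q ^ m) _ ⟨
    q * q ^ m * f (inside ∷ T₁)    ∎)
    where open ℕ.≤-Reasoning

  -- A point of `p` leaves only its inside branch, while any other point contributes the factor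
  -- `1 + q-1`. So `p` is contained in the random set with probability `1 / q ^ ∣ p ∣`.
  W-⊆ : (p : Subset m) → q ^ ∣ p ∣ * W (λ T → indicator (p ⊆? T)) ≡ q ^ m
  W-⊆ [] = refl
  W-⊆ {suc m} (inside ∷ p) rewrite W-0 m | ℕ.*-zeroʳ q-1
    | ℕ.+-identityʳ (W (λ T → indicator (p ⊆? T))) =
    trans (ℕ.*-assoc q (q ^ ∣ p ∣) _) (cong (q *_) (W-⊆ p))
  W-⊆ (outside ∷ p) =
    trans (swap (q ^ ∣ p ∣) q _) (cong (q *_) (W-⊆ p))
    where
    swap : ∀ a b c → a * (b * c) ≡ b * (a * c)
    swap = solve-∀

  -- The alteration method: the expected number of points of T that are lost in X T
  -- is at most m l / q ^ 4, while the expected size of T is m / q.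
  alteration : (X : Subset m → Subset m) (bad : Fin m → Subset m → ℕ) (l : ℕ) →
    (∀ T v → v ∈ T → v ∉ X T → 1 ≤ bad v T) →
    (∀ v → q ^ 4 * W (bad v) ≤ l * q ^ m) →
    ∃[ T ] m * q ^ 3 ≤ q ^ 4 * ∣ X T ∣ + m * l
  alteration {m} X bad l lost few with W-max (∣_∣ ∘ X)
  ... | T , ≤T = T , ℕ.*-cancelʳ-≤ _ _ (q ^ m) ⦃ ℕ.m^n≢0 q m ⦄ (begin
    m * q ^ 3 * q ^ m                                     ≡⟨ ℕ.*-assoc m (q ^ 3) _ ⟩
    m * (q ^ 3 * q ^ m)                                   ≡⟨ sum-const m _ ⟨
    ∑[ v < m ] (q ^ 3 * q ^ m)                            ≤⟨ sum-mono-≤ local ⟩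
    ∑[ v < m ] (q ^ 4 * W (kept v) + l * q ^ m)           ≡⟨ ∑-distrib-+ (λ v → q ^ 4 * W (kept v)) _ ⟩
    ∑[ v < m ] (q ^ 4 * W (kept v)) + ∑[ v < m ] (l * q ^ m)
      ≡⟨ cong₂ _+_ (sum-*ˡ (q ^ 4) (W ∘ kept)) (sum-const m _) ⟩
    q ^ 4 * ∑[ v < m ] W (kept v) + m * (l * q ^ m)
      ≡⟨ cong (λ z → q ^ 4 * z + m * (l * q ^ m)) (W-sum kept) ⟨
    q ^ 4 * W (λ S → ∑[ v < m ] kept v S) + m * (l * q ^ m)
      ≤⟨ ℕ.+-monoˡ-≤ _ (ℕ.*-monoʳ-≤ (q ^ 4) (W-mono-≤ λ S → ℕ.≤-reflexive (sym (∣p∣≡sum (X S))))) ⟩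
    q ^ 4 * W (∣_∣ ∘ X) + m * (l * q ^ m)                 ≤⟨ ℕ.+-monoˡ-≤ _ (ℕ.*-monoʳ-≤ (q ^ 4) ≤T) ⟩
    q ^ 4 * (q ^ m * ∣ X T ∣) + m * (l * q ^ m)           ≡⟨ factor (q ^ 4) (q ^ m) ∣ X T ∣ m l ⟩
    (q ^ 4 * ∣ X T ∣ + m * l) * q ^ m                     ∎)
    where
    open ℕ.≤-Reasoning
    kept : Fin m → Subset m → ℕ
    kept v S = indicator (v ∈? X S)
    factor : ∀ a b c d e → a * (b * c) + d * (e * b) ≡ (a * c + d * e) * b
    factor = solve-∀
    pull : ∀ a b → a ^ 3 * (a ^ 1 * b) ≡ a ^ 4 * b
    pull a b = trans (sym (ℕ.*-assoc (a ^ 3) (a ^ 1) b))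
      (cong (_* b) (sym (ℕ.^-distribˡ-+-* a 3 1)))

    split : ∀ v S → indicator (⁅ v ⁆ ⊆? S) ≤ kept v S + bad v S
    split v S with v ∈? X S
    ... | yes _   = indicator-≤ (⁅ v ⁆ ⊆? S) λ _ → s≤s z≤n
    ... | no v∉XS = indicator-≤ (⁅ v ⁆ ⊆? S) λ v⊆S → lost S v (v⊆S (x∈⁅x⁆ v)) v∉XS

    -- The event `v ∈ S` has probability `1 / q`. Scaling by `q ^ 4` turns this into `q ^ 3`, and it
    -- turns the probability of containing four given points into 1.
    local : ∀ v → q ^ 3 * q ^ m ≤ q ^ 4 * W (kept v) + l * q ^ m
    local v = begin
      q ^ 3 * q ^ m
        ≡⟨ cong (q ^ 3 *_) (W-⊆ ⁅ v ⁆) ⟨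
      q ^ 3 * (q ^ ∣ ⁅ v ⁆ ∣ * W (λ S → indicator (⁅ v ⁆ ⊆? S)))
        ≡⟨ cong (λ k → q ^ 3 * (q ^ k * W (λ S → indicator (⁅ v ⁆ ⊆? S)))) (∣⁅x⁆∣≡1 v) ⟩
      q ^ 3 * (q ^ 1 * W (λ S → indicator (⁅ v ⁆ ⊆? S)))
        ≡⟨ pull q _ ⟩
      q ^ 4 * W (λ S → indicator (⁅ v ⁆ ⊆? S))
        ≤⟨ ℕ.*-monoʳ-≤ (q ^ 4) (W-mono-≤ (split v)) ⟩
      q ^ 4 * W (λ S → kept v S + bad v S)
        ≡⟨ cong (q ^ 4 *_) (W-+ (kept v) (bad v)) ⟩
      q ^ 4 * (W (kept v) + W (bad v))
        ≡⟨ ℕ.*-distribˡ-+ (q ^ 4) (W (kept v)) _ ⟩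
      q ^ 4 * W (kept v) + q ^ 4 * W (bad v)
        ≤⟨ ℕ.+-monoʳ-≤ (q ^ 4 * W (kept v)) (few v) ⟩
      q ^ 4 * W (kept v) + l * q ^ m ∎

-- A proper colouring with n² colours.

module LatinColouring (n : ℕ) .⦃ _ : NonZero n ⦄ where

  infixl 6 _⊕_

  _⊕_ : Fin n → Fin n → Fin n
  x ⊕ y = fromℕ< (m%n<n (toℕ x + toℕ y) n)

  ⊕-comm : ∀ x y → x ⊕ y ≡ y ⊕ x
  ⊕-comm x y = Fin.fromℕ<-cong _ _ (cong (_% n) (ℕ.+-comm (toℕ x) (toℕ y))) _ _

  -- Adding `n ∸ toℕ x` undoes the shift by `x` modulo `n`, and elements of `Fin n` are their own
  -- residues.
  ⊕-cancelˡ : ∀ x {y z} → x ⊕ y ≡ x ⊕ z → y ≡ z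
  ⊕-cancelˡ x {y} {z} xy≡xz = Fin.toℕ-injective
    (trans (sym (shift y)) (trans (cong (λ k → (n ∸ toℕ x + k) % n) residues) (shift z)))
    where
    residues : (toℕ x + toℕ y) % n ≡ (toℕ x + toℕ z) % n
    residues = Fin.fromℕ<-injective _ _ _ _ xy≡xz

    mod-absorb : ∀ a b → (a + b % n) % n ≡ (a + b) % n
    mod-absorb a b = begin
      (a + b % n) % n          ≡⟨ %-distribˡ-+ a (b % n) n ⟩
      (a % n + b % n % n) % n  ≡⟨ cong (λ k → (a % n + k) % n) (m%n%n≡m%n b n) ⟩
      (a % n + b % n) % n      ≡⟨ %-distribˡ-+ a b n ⟨
      (a + b) % n              ∎
      where open ≡-Reasoning

    shift : ∀ w → (n ∸ toℕ x + (toℕ x + toℕ w) % n) % n ≡ toℕ w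
    shift w = begin
      (n ∸ toℕ x + (toℕ x + toℕ w) % n) % n  ≡⟨ mod-absorb (n ∸ toℕ x) _ ⟩
      (n ∸ toℕ x + (toℕ x + toℕ w)) % n      ≡⟨ cong (_% n) (ℕ.+-assoc (n ∸ toℕ x) _ _) ⟨
      (n ∸ toℕ x + toℕ x + toℕ w) % n
        ≡⟨ cong (λ k → (k + toℕ w) % n) (ℕ.m∸n+n≡m (ℕ.<⇒≤ (Fin.toℕ<n x))) ⟩
      (n + toℕ w) % n                        ≡⟨ cong (_% n) (ℕ.+-comm n _) ⟩
      (toℕ w + n) % n                        ≡⟨ [m+n]%n≡m%n (toℕ w) n ⟩
      toℕ w % n                              ≡⟨ m<n⇒m%n≡m (Fin.toℕ<n w) ⟩
      toℕ w                                  ∎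
      where open ≡-Reasoning

  ⊕-cancelʳ : ∀ {x y} z → x ⊕ z ≡ y ⊕ z → x ≡ y
  ⊕-cancelʳ {x} {y} z xz≡yz =
    ⊕-cancelˡ z (trans (⊕-comm z x) (trans xz≡yz (⊕-comm y z)))

  -- The cell with offset (j , l) in block (i , k) gets the pair (j ⊕ k , i ⊕ l).
  colour : Fin (n * n) → Fin (n * n) → Fin (n * n)
  colour a b = combine (remainder {n} n a ⊕ quotient {n} n b)
                       (quotient {n} n a ⊕ remainder {n} n b)

  quotRem-injective : ∀ {a b : Fin (n * n)} →
    quotient {n} n a ≡ quotient {n} n b → remainder {n} n a ≡ remainder {n} n b → a ≡ b
  quotRem-injective {a} {b} q≡ r≡ = trans (sym (Fin.combine-remQuot {n} n a))
    (trans (cong₂ combine q≡ r≡) (Fin.combine-remQuot {n} n b))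

  -- Within a row both digits of `a` are known, and cancelling them in the two components gives both
  -- digits of `b`; columns are symmetric. Within a block the two quotients are known, and
  -- cancelling them gives the two remainders.
  colour-injective : ∀ {a b α β} → Related n (a , b) (α , β) →
    colour a b ≡ colour α β → a ≡ α × b ≡ β
  colour-injective {a} {b} {α} {β} related same
    with Fin.combine-injective (remainder {n} n a ⊕ quotient {n} n b) _ _ _ same
  ... | s₁ , s₂ with related
  ...   | inj₁ refl = refl , quotRem-injective
            (⊕-cancelˡ (remainder {n} n a) s₁) (⊕-cancelˡ (quotient {n} n a) s₂)
  ...   | inj₂ (inj₁ refl) = quotRem-injective
            (⊕-cancelʳ (remainder {n} n b) s₂) (⊕-cancelʳ (quotient {n} n b) s₁) , refl
  ...   | inj₂ (inj₂ (qa , qb)) =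
            quotRem-injective qa (⊕-cancelʳ (quotient {n} n b)
              (trans s₁ (cong (remainder {n} n α ⊕_) (sym qb)))) ,
            quotRem-injective qb (⊕-cancelˡ (quotient {n} n a)
              (trans s₂ (cong (_⊕ remainder {n} n β) (sym qa))))

  colourable : Colourable (Sud n) (n * n)
  colourable = uncurry colour ∘ cell n , λ u v (u≢v , related) same →
    let a≡ , b≡ = colour-injective related same in
    u≢v (trans (sym (Fin.combine-remQuot {n * n} (n * n) u))
      (trans (cong₂ combine a≡ b≡) (Fin.combine-remQuot {n * n} (n * n) v)))

-- Every colour occurs in each row, column and block.

-- Pigeonhole: if `y` were missed, punching it out would leave an injection into a set with fewer
-- than `m` elements.
injective⇒surjective : ∀ {f : Fin m → Fin n} → n ≤ m → Injective _≡_ _≡_ f →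
  ∀ y → ∃[ x ] f x ≡ y
injective⇒surjective {n = suc n} {f} n≤m inj y with Fin.any? (λ x → f x Fin.≟ y)
... | yes hit = hit
... | no miss = contradiction
  (Fin.injective⇒≤ {f = λ x → punchOut (y≢f x)}
    λ {x} {x′} → inj ∘ Fin.punchOut-injective (y≢f x) (y≢f x′))
  (ℕ.<⇒≱ n≤m)
  where
  y≢f : ∀ x → y ≢ f x
  y≢f x y≡fx = miss (x , sym y≡fx)

related-adj : ∀ n {u v} → u ≢ v → Related n u v →
  Adj (Sud n) (uncurry combine u) (uncurry combine v)
related-adj n {a , b} {α , β} u≢v r =
  (λ eq → u≢v (uncurry (cong₂ _,_) (Fin.combine-injective a b α β eq))) ,
  subst₂ (Related n) (sym (Fin.remQuot-combine a b)) (sym (Fin.remQuot-combine α β)) r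

module ColouredSudoku (n : ℕ) (χ≤n² : χ (Sud n) ≤ n * n)
  (c : Colouring (Sud n)) (proper : Proper (Sud n) c) where

  N : ℕ
  N = n * n

  Cell : Set
  Cell = Fin N × Fin N

  Colour : Set
  Colour = Fin (χ (Sud n))

  vertex : Cell → V (Sud n)
  vertex = uncurry combine

  vertex-injective : ∀ {u v} → vertex u ≡ vertex v → u ≡ v
  vertex-injective {a , b} {α , β} eq =
    uncurry (cong₂ _,_) (Fin.combine-injective a b α β eq)

  vertex-cell : ∀ v → vertex (cell n v) ≡ v
  vertex-cell = Fin.combine-remQuot {N} N

  c′ : Cell → Colour
  c′ = c ∘ vertex

  related-colours : ∀ {u v} → Related n u v → c′ u ≡ c′ v → u ≡ v
  related-colours {a , b} {α , β} r same with a Fin.≟ α | b Fin.≟ β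
  ... | yes refl | yes refl = refl
  ... | no a≢    | _        = contradiction same (proper _ _ (related-adj n (a≢ ∘ cong proj₁) r))
  ... | yes _    | no b≢    = contradiction same (proper _ _ (related-adj n (b≢ ∘ cong proj₂) r))

  -- The `N` cells of a clique have distinct colours, and the palette has at most `N`.
  clique-hits : (g : Fin N → Cell) → Injective _≡_ _≡_ g →
    (∀ x y → Related n (g x) (g y)) → ∀ y → ∃[ x ] c′ (g x) ≡ y
  clique-hits g g-inj clique = injective⇒surjective χ≤n²
    λ {x} {y} → g-inj ∘ related-colours (clique x y)

  row-hits : ∀ a y → ∃[ b ] c′ (a , b) ≡ y
  row-hits a = clique-hits (a ,_) (cong proj₂) λ _ _ → inj₁ refl

  column-hits : ∀ b y → ∃[ a ] c′ (a , b) ≡ y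
  column-hits b = clique-hits (_, b) (cong proj₁) λ _ _ → inj₂ (inj₁ refl)

  blockCell : Cell → Fin n → Fin n → Cell
  blockCell (a , b) j l = combine (quotient {n} n a) j , combine (quotient {n} n b) l

  quotient-combine : ∀ (i j : Fin n) → quotient {n} n (combine i j) ≡ i
  quotient-combine i j = cong proj₁ (Fin.remQuot-combine i j)

  block-hits : ∀ v y → ∃[ j ] ∃[ l ] c′ (blockCell v j l) ≡ y
  block-hits v y with clique-hits (λ x → blockCell v (quotient {n} n x) (remainder {n} n x))
      (λ {x} {y} eq → trans (sym (Fin.combine-remQuot {n} n x))
        (trans (cong₂ combine
          (Fin.combine-injectiveʳ (quotient {n} n (proj₁ v)) (quotient {n} n x)
            (quotient {n} n (proj₁ v)) (quotient {n} n y) (cong proj₁ eq))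
          (Fin.combine-injectiveʳ (quotient {n} n (proj₂ v)) (remainder {n} n x)
            (quotient {n} n (proj₂ v)) (remainder {n} n y) (cong proj₂ eq)))
        (Fin.combine-remQuot {n} n y)))
      (λ x y → inj₂ (inj₂ (trans (quotient-combine _ _) (sym (quotient-combine _ _)) ,
                           trans (quotient-combine _ _) (sym (quotient-combine _ _)))))
      y
  ... | x , hit = quotient {n} n x , remainder {n} n x , hit

  block-related : ∀ v j l → Related n (blockCell v j l) v
  block-related v j l = inj₂ (inj₂ (quotient-combine _ _ , quotient-combine _ _))

  rowCell columnCell : Cell → Cell → Cell
  rowCell    (a , b) w = a , proj₁ (row-hits a (c′ w))
  columnCell (a , b) w = proj₁ (column-hits b (c′ w)) , b

  rowCell-colour : ∀ v w → c′ (rowCell v w) ≡ c′ w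
  rowCell-colour (a , b) w = proj₂ (row-hits a (c′ w))

  columnCell-colour : ∀ v w → c′ (columnCell v w) ≡ c′ w
  columnCell-colour (a , b) w = proj₂ (column-hits b (c′ w))

  -- The forced vertices and the determining set.

  -- The block occurrence `w` is left out because it may coincide with the row or column occurrence;
  -- the three vertices here are distinct as soon as `v` and `w` differ in colour.
  cross : Cell → Cell → Subset (order (Sud n))
  cross v w = ⁅ vertex v ⁆ ∪ (⁅ vertex (rowCell v w) ⁆ ∪ ⁅ vertex (columnCell v w) ⁆)

  -- All occurrences of the colour of w in the row, column and block of v are in T, as is v.
  Saturated : Subset (order (Sud n)) → Cell → Cell → Set
  Saturated T v w = w ≢ v × ⁅ vertex w ⁆ ∪ cross v w ⊆ T

  _≟ᶜ_ : (u v : Cell) → Dec (u ≡ v)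
  _≟ᶜ_ = Product.≡-dec Fin._≟_ Fin._≟_

  saturated? : ∀ T v w → Dec (Saturated T v w)
  saturated? T v w = ¬? (w ≟ᶜ v) ×-dec (⁅ vertex w ⁆ ∪ cross v w ⊆? T)

  -- Letting `w` run through the block of `v` covers every colour, by `block-hits`, and makes the
  -- competing colours n² explicit offsets to sum over.
  Free : Subset (order (Sud n)) → V (Sud n) → Set
  Free T v = v ∈ T × (∀ j l → ¬ Saturated T (cell n v) (blockCell (cell n v) j l))

  free? : ∀ T v → Dec (Free T v)
  free? T v = v ∈? T ×-dec Fin.all? λ j → Fin.all? λ l → ¬? (saturated? T _ _)

  free : Subset (order (Sud n)) → Subset (order (Sud n))
  free T = comprehension (free? T)

  -- A vertex of free T sees every colour other than its own outside T.
  ∁-free-determining : ∀ T → Determining (Sud n) c (∁ (free T))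
  ∁-free-determining T d proper-d agree v with d v Fin.≟ c v
  ... | yes dv≡cv = dv≡cv
  ... | no  dv≢cv with v ∈? free T
  ...   | no  v∉ = agree v (x∉p⇒x∈∁p v∉)
  ...   | yes v∈ with ∈-comprehension⁻ (free? T) v∈ | block-hits (cell n v) (d v)
  -- A new colour `d v` has an occurrence under `c` in the block of `v`; this cell turns out to be
  -- saturated, against freeness.
  ...     | v∈T , unsaturated | j , l , hit = ⊥-elim (unsaturated j l (w≢v , all∈T))
    where
    z w : Cell
    z = cell n v
    w = blockCell z j l

    colour-differs : ∀ {u} → c′ u ≡ d v → u ≢ z
    colour-differs same refl = dv≢cv (trans (sym same) (cong c (vertex-cell v)))

    w≢v : w ≢ z
    w≢v = colour-differs hit

    -- A vertex outside `T` is not free, so `d` agrees with `c` there; it would be a neighbour of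
    -- `v` with colour `d v` under `d`.
    sees⇒∈T : ∀ u → Related n u z → c′ u ≡ d v → vertex u ∈ T
    sees⇒∈T u r same with vertex u ∈? T
    ... | yes u∈T = u∈T
    ... | no  u∉T = contradiction
      (trans (agree (vertex u) (x∉p⇒x∈∁p (u∉T ∘ proj₁ ∘ ∈-comprehension⁻ (free? T)))) same)
      (proper-d (vertex u) v
        (subst (Adj (Sud n) (vertex u)) (vertex-cell v) (related-adj n (colour-differs same) r)))

    all∈T : ⁅ vertex w ⁆ ∪ cross z w ⊆ T
    all∈T = ⁅x⁆∪p⊆q (sees⇒∈T w (block-related z j l) hit)
      (⁅x⁆∪p⊆q (subst (_∈ T) (sym (vertex-cell v)) v∈T)
      (⁅x⁆∪p⊆q (sees⇒∈T (rowCell z w) (inj₁ refl) (trans (rowCell-colour z w) hit))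
      λ x∈ → subst (_∈ T) (sym (x∈⁅y⁆⇒x≡y _ x∈))
        (sees⇒∈T (columnCell z w) (inj₂ (inj₁ refl)) (trans (columnCell-colour z w) hit))))

  -- Number of vertices that saturation requires.

  module _ {v w : Cell} (cv≢cw : c′ v ≢ c′ w) where

    colour⇒≢ : ∀ {u} → c′ u ≡ c′ w → v ≢ u
    colour⇒≢ same refl = cv≢cw same

    -- A cell common to the row and the column of `v` is `v` itself, whose colour is different.
    row≢column : rowCell v w ≢ columnCell v w
    row≢column eq = colour⇒≢ {rowCell v w} (rowCell-colour v w)
      (cong (proj₁ v ,_) (sym (cong proj₂ eq)))

    ∣cross∣ : ∣ cross v w ∣ ≡ 3
    ∣cross∣ = trans (∣⁅x⁆∪p∣≡1+∣p∣ (x∉⁅y⁆∪p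
        (colour⇒≢ (rowCell-colour v w) ∘ vertex-injective)
        (colour⇒≢ (columnCell-colour v w) ∘ vertex-injective ∘ x∈⁅y⁆⇒x≡y _)))
      (cong suc (trans (∣⁅x⁆∪p∣≡1+∣p∣ (row≢column ∘ vertex-injective ∘ x∈⁅y⁆⇒x≡y _))
        (cong suc (∣⁅x⁆∣≡1 (vertex (columnCell v w))))))

    -- Every cell of the cross lies in the row or the column of `v`, so `w` is a fourth vertex.
    ∣w∪cross∣ : proj₁ w ≢ proj₁ v → proj₂ w ≢ proj₂ v → ∣ ⁅ vertex w ⁆ ∪ cross v w ∣ ≡ 4
    ∣w∪cross∣ ≢row ≢column = trans (∣⁅x⁆∪p∣≡1+∣p∣ (x∉⁅y⁆∪p
        (≢row ∘ cong proj₁ ∘ vertex-injective) (x∉⁅y⁆∪p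
        (≢row ∘ cong proj₁ ∘ vertex-injective)
        (≢column ∘ cong proj₂ ∘ vertex-injective ∘ x∈⁅y⁆⇒x≡y _))))
      (cong suc ∣cross∣)

  -- Expected number of losses.

  module _ (q-1 : ℕ) where
    open Random q-1

    M : ℕ
    M = order (Sud n)

    bad : V (Sud n) → Subset M → ℕ
    bad v T = ∑[ j < n ] ∑[ l < n ]
      indicator (saturated? T (cell n v) (blockCell (cell n v) j l))

    free-lost : ∀ T v → v ∈ T → v ∉ free T → 1 ≤ bad v T
    free-lost T v v∈T v∉free
      with Fin.any? (λ j → Fin.any? (λ l → saturated? T (cell n v) (blockCell (cell n v) j l)))
    ... | yes (j , l , sat) = ℕ.≤-trans (indicator-yes (saturated? T _ _) sat)
      (ℕ.≤-trans (term≤sum (λ l → indicator (saturated? T _ (blockCell _ j l))) l)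
                 (term≤sum (λ j → ∑[ l < n ] indicator (saturated? T _ (blockCell _ j l))) j))
    ... | no unsat = contradiction
      (∈-comprehension⁺ (free? T) (v∈T , λ j l sat → unsat (j , l , sat))) v∉free

    -- If w lies in the row or column of v then it is itself one of the cells in cross v w,
    -- so only three vertices instead of four are required to be in T.
    weight : Cell → Fin n → Fin n → ℕ
    weight (a , b) j l =
      1 + q * (indicator (j Fin.≟ remainder {n} n a) + indicator (l Fin.≟ remainder {n} n b))

    -- Each of the two indicators is 1 at `n` of the n² offsets. Dividing the total by q³ gives the
    -- bound n²/q³ + 2n/q² on the loss conditional on `v ∈ T`.
    sum-weight : ∀ v → ∑[ j < n ] ∑[ l < n ] weight v j l ≡ n * n + q * (n + n)
    sum-weight (a , b) = begin
      ∑[ j < n ] ∑[ l < n ] weight (a , b) j l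
        ≡⟨ sum-cong-≗ inner ⟩
      ∑[ j < n ] (n * 1 + q * (n * δ j + 1))
        ≡⟨ ∑-distrib-+ {n} (λ _ → n * 1) _ ⟩
      ∑[ j < n ] (n * 1) + ∑[ j < n ] (q * (n * δ j + 1))
        ≡⟨ cong₂ _+_ (sum-const n _) (sum-*ˡ {n} q _) ⟩
      n * (n * 1) + q * ∑[ j < n ] (n * δ j + 1)
        ≡⟨ cong (λ k → n * (n * 1) + q * k) (∑-distrib-+ {n} (λ j → n * δ j) _) ⟩
      n * (n * 1) + q * (∑[ j < n ] (n * δ j) + ∑[ j < n ] 1)
        ≡⟨ cong (λ k → n * (n * 1) + q * k) (cong₂ _+_
             (trans (sum-*ˡ n δ) (cong (n *_) (sum-≟ (remainder {n} n a)))) (sum-const n 1)) ⟩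
      n * (n * 1) + q * (n * 1 + n * 1)
        ≡⟨ cong (λ k → n * k + q * (k + k)) (ℕ.*-identityʳ n) ⟩
      n * n + q * (n + n) ∎
      where
      open ≡-Reasoning
      δ : Fin n → ℕ
      δ j = indicator (j Fin.≟ remainder {n} n a)
      ε : Fin n → ℕ
      ε l = indicator (l Fin.≟ remainder {n} n b)

      inner : ∀ j → ∑[ l < n ] weight (a , b) j l ≡ n * 1 + q * (n * δ j + 1)
      inner j = begin
        ∑[ l < n ] weight (a , b) j l
          ≡⟨ ∑-distrib-+ {n} (λ _ → 1) _ ⟩
        ∑[ l < n ] 1 + ∑[ l < n ] (q * (δ j + ε l))
          ≡⟨ cong₂ _+_ (sum-const n 1) (sum-*ˡ {n} q _) ⟩
        n * 1 + q * ∑[ l < n ] (δ j + ε l)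
          ≡⟨ cong (λ k → n * 1 + q * k) (∑-distrib-+ {n} (λ _ → δ j) ε) ⟩
        n * 1 + q * (∑[ l < n ] δ j + ∑[ l < n ] ε l)
          ≡⟨ cong (λ k → n * 1 + q * k) (cong₂ _+_ (sum-const n (δ j)) (sum-≟ (remainder {n} n b))) ⟩
        n * 1 + q * (n * δ j + 1) ∎

    -- Off the row and column of `v`, saturation puts four distinct vertices into `T`; otherwise,
    -- for `w ≢ v`, the three vertices of the cross are used. After scaling by `q ^ 4` the
    -- probabilities are 1 and `q`.
    W-saturated : ∀ v j l →
      q ^ 4 * W (λ T → indicator (saturated? T v (blockCell v j l))) ≤ weight v j l * q ^ M
    W-saturated v@(a , b) j l = [ degenerate , generic ]′ (Dec.toSum (w ≟ᶜ v))
      where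
      open ℕ.≤-Reasoning
      w : Cell
      w = blockCell v j l

      degenerate : w ≡ v →
        q ^ 4 * W (λ T → indicator (saturated? T v w)) ≤ weight v j l * q ^ M
      degenerate w≡v = begin
        q ^ 4 * W (λ T → indicator (saturated? T v w))
          ≤⟨ ℕ.*-monoʳ-≤ (q ^ 4) (W-mono-≤ {M} λ T →
               ℕ.≤-reflexive (indicator-no (saturated? T v w) λ (w≢v , _) → w≢v w≡v)) ⟩
        q ^ 4 * W {M} (λ _ → 0)  ≡⟨ cong (q ^ 4 *_) (W-0 M) ⟩
        q ^ 4 * 0                ≡⟨ ℕ.*-zeroʳ (q ^ 4) ⟩
        0                        ≤⟨ z≤n ⟩
        weight v j l * q ^ M     ∎

      generic : w ≢ v →
        q ^ 4 * W (λ T → indicator (saturated? T v w)) ≤ weight v j l * q ^ M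
      generic w≢v = bound
        where
        cv≢cw : c′ v ≢ c′ w
        cv≢cw same = w≢v (related-colours {w} {v} (block-related v j l) (sym same))

        four : j ≢ remainder {n} n a → l ≢ remainder {n} n b → ∣ ⁅ vertex w ⁆ ∪ cross v w ∣ ≡ 4
        four j≢ l≢ = ∣w∪cross∣ {v} {w} cv≢cw (offset a j≢) (offset b l≢)
          where
          offset : ∀ e {i} → i ≢ remainder {n} n e → combine (quotient {n} n e) i ≢ e
          offset e {i} i≢ eq = i≢ (Fin.combine-injectiveʳ (quotient {n} n e) i _ _
            (trans eq (sym (Fin.combine-remQuot {n} n e))))

        light : ∣ ⁅ vertex w ⁆ ∪ cross v w ∣ ≡ 4 →
          q ^ 4 * W (λ T → indicator (saturated? T v w)) ≤ q ^ M
        light ≡4 = begin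
          q ^ 4 * W (λ T → indicator (saturated? T v w))
            ≤⟨ ℕ.*-monoʳ-≤ (q ^ 4) (W-mono-≤ {M} λ T →
                 indicator-≤ (saturated? T v w) λ (_ , ⊆T) → indicator-yes (_ ⊆? T) ⊆T) ⟩
          q ^ 4 * W (λ T → indicator (⁅ vertex w ⁆ ∪ cross v w ⊆? T))
            ≡⟨ cong (λ k → q ^ k * W (λ T → indicator (⁅ vertex w ⁆ ∪ cross v w ⊆? T))) ≡4 ⟨
          q ^ ∣ ⁅ vertex w ⁆ ∪ cross v w ∣ * W (λ T → indicator (⁅ vertex w ⁆ ∪ cross v w ⊆? T))
            ≡⟨ W-⊆ (⁅ vertex w ⁆ ∪ cross v w) ⟩
          q ^ M ∎

        heavy : q ^ 4 * W (λ T → indicator (saturated? T v w)) ≤ q * q ^ M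
        heavy = begin
          q ^ 4 * W (λ T → indicator (saturated? T v w))
            ≤⟨ ℕ.*-monoʳ-≤ (q ^ 4) (W-mono-≤ {M} λ T → indicator-≤ (saturated? T v w)
                 λ (_ , ⊆T) → indicator-yes (_ ⊆? T) (⊆T ∘ q⊆p∪q ⁅ vertex w ⁆ (cross v w))) ⟩
          q ^ 4 * W (λ T → indicator (cross v w ⊆? T))
            ≡⟨ ℕ.*-assoc q (q ^ 3) _ ⟩
          q * (q ^ 3 * W (λ T → indicator (cross v w ⊆? T)))
            ≡⟨ cong (λ k → q * (q ^ k * W (λ T → indicator (cross v w ⊆? T)))) (∣cross∣ {v} {w} cv≢cw) ⟨
          q * (q ^ ∣ cross v w ∣ * W (λ T → indicator (cross v w ⊆? T)))
            ≡⟨ cong (q *_) (W-⊆ (cross v w)) ⟩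
          q * q ^ M ∎

        widen : ∀ {k} → 1 ≤ k → q * q ^ M ≤ (1 + q * k) * q ^ M
        widen {k} 1≤k = ℕ.*-monoˡ-≤ (q ^ M)
          (ℕ.m≤n⇒m≤1+n (ℕ.≤-trans (ℕ.≤-reflexive (sym (ℕ.*-identityʳ q))) (ℕ.*-monoʳ-≤ q 1≤k)))

        bound : q ^ 4 * W (λ T → indicator (saturated? T v w)) ≤ weight v j l * q ^ M
        bound with j Fin.≟ remainder {n} n a | l Fin.≟ remainder {n} n b
        ... | no j≢ | no l≢ = ℕ.≤-trans (light (four j≢ l≢)) (ℕ.m≤m+n (q ^ M) _)
        ... | yes _ | l≟    = ℕ.≤-trans heavy (widen {1 + indicator l≟} (s≤s z≤n))
        ... | no _  | yes _ = ℕ.≤-trans heavy (widen {1} (s≤s z≤n))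

    bad-few : ∀ v → q ^ 4 * W (bad v) ≤ (n * n + q * (n + n)) * q ^ M
    bad-few v = begin
      q ^ 4 * W (bad v)
        ≡⟨ cong (q ^ 4 *_) (trans
             (W-sum (λ j T → ∑[ l < n ] sat j l T)) (sum-cong-≗ λ j → W-sum (sat j))) ⟩
      q ^ 4 * ∑[ j < n ] ∑[ l < n ] W (sat j l)
        ≡⟨ sum-*ˡ {n} (q ^ 4) _ ⟨
      ∑[ j < n ] (q ^ 4 * ∑[ l < n ] W (sat j l))
        ≡⟨ sum-cong-≗ (λ j → sum-*ˡ (q ^ 4) (W ∘ sat j)) ⟨
      ∑[ j < n ] ∑[ l < n ] (q ^ 4 * W (sat j l))
        ≤⟨ sum-mono-≤ (λ j → sum-mono-≤ (W-saturated (cell n v) j)) ⟩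
      ∑[ j < n ] ∑[ l < n ] (weight (cell n v) j l * q ^ M)
        ≡⟨ sum-cong-≗ (λ j → sum-*ʳ (weight (cell n v) j) (q ^ M)) ⟩
      ∑[ j < n ] ((∑[ l < n ] weight (cell n v) j l) * q ^ M)
        ≡⟨ sum-*ʳ {n} _ (q ^ M) ⟩
      (∑[ j < n ] ∑[ l < n ] weight (cell n v) j l) * q ^ M
        ≡⟨ cong (_* q ^ M) (sum-weight (cell n v)) ⟩
      (n * n + q * (n + n)) * q ^ M ∎
      where
      open ℕ.≤-Reasoning
      sat : Fin n → Fin n → Subset M → ℕ
      sat j l T = indicator (saturated? T (cell n v) (blockCell (cell n v) j l))

    ∃-large-free : ∃[ T ] M * q ^ 3 ≤ q ^ 4 * ∣ free T ∣ + M * (n * n + q * (n + n))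
    ∃-large-free = alteration free bad _ free-lost bad-few

-- From determining sets to critical sets.

-- Descending through strictly smaller determining subsets ends at a critical set contained in `S`.
scs≤∣determining∣ : ∀ G c S → Determining G c S → scs G c ≤ ∣ S ∣
scs≤∣determining∣ G c S = go S (⊂-wellFounded S)
  where
  go : ∀ S → Acc _⊂_ S → Determining G c S → scs G c ≤ ∣ S ∣
  go S (acc rec) dS with anySubset? (λ T → T ⊂? S ×-dec determining? G c T)
  ... | yes (T , T⊂S , dT) = ℕ.≤-trans (go T (rec T⊂S) dT) (p⊆q⇒∣p∣≤∣q∣ (proj₁ T⊂S))
  ... | no ¬∃ = proj₂ (scs-isLeast G c) ∣ S ∣
    (S , (dS , λ T T⊂S dT → ¬∃ (T , T⊂S , dT)) , refl)

-- Choice of the density and the resulting bound.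

-- Take the least `q` with 4n² ≤ q³. Minimality gives (q - 1)³ < 4n², and q ≤ 2(q - 1) for q ≥ 2,
-- whence the factor 32 = 8 · 4.
∃-scale : ∀ n .⦃ _ : NonZero n ⦄ →
  ∃[ p ] 4 * (n * n) ≤ suc p ^ 3 × suc p ^ 3 ≤ 32 * (n * n)
∃-scale n@(suc _) with least (λ k → 4 * (n * n) ℕ.≤? k ^ 3) (4 * (n * n)) (m≤m^3 (4 * (n * n)))
  where
  m≤m^3 : ∀ m → m ≤ m ^ 3
  m≤m^3 zero    = z≤n
  m≤m^3 (suc m) = ℕ.m≤m*n (suc m) (suc m ^ 2) ⦃ ℕ.m^n≢0 (suc m) 2 ⦄
... | zero , () , _
... | suc zero , 4n²≤1 , _ = zero , 4n²≤1 , s≤s z≤n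
... | suc p@(suc r) , 4n²≤q³ , minimal = p , 4n²≤q³ , (begin
  suc p ^ 3            ≤⟨ ℕ.^-monoˡ-≤ 3 (ℕ.+-monoˡ-≤ p (s≤s (z≤n {r}))) ⟩
  (p + p) ^ 3          ≡⟨ double p ⟩
  8 * p ^ 3            ≤⟨ ℕ.*-monoʳ-≤ 8 (ℕ.<⇒≤ (ℕ.≰⇒> λ 4n²≤p³ → ℕ.1+n≰n (minimal p 4n²≤p³))) ⟩
  8 * (4 * (n * n))    ≡⟨ ℕ.*-assoc 8 4 (n * n) ⟨
  32 * (n * n)         ∎)
  where
  open ℕ.≤-Reasoning
  double : ∀ a → (a + a) * ((a + a) * ((a + a) * 1)) ≡ 8 * (a * (a * (a * 1)))
  double = solve-∀

-- Otherwise q⁶ < 512n³ = 32 · 16n³ ≤ 16n⁴, whereas squaring the hypothesis on `q` gives 16n⁴ ≤ q⁶.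
-- This is the source of the threshold 32.
8n≤q² : ∀ n q → 32 ≤ n → 4 * (n * n) ≤ q ^ 3 → 8 * n ≤ q ^ 2
8n≤q² n q 32≤n 4n²≤q³ = ℕ.≮⇒≥ λ q²<8n → ℕ.<-irrefl refl (begin-strict
  (q ^ 2) ^ 3            <⟨ ℕ.^-monoˡ-< 3 q²<8n ⟩
  (8 * n) ^ 3            ≡⟨ expand n ⟩
  32 * (16 * (n * (n * n)))  ≤⟨ ℕ.*-monoˡ-≤ _ 32≤n ⟩
  n * (16 * (n * (n * n)))   ≡⟨ collect n ⟩
  (4 * (n * n)) ^ 2      ≤⟨ ℕ.^-monoˡ-≤ 2 4n²≤q³ ⟩
  (q ^ 3) ^ 2            ≡⟨ ℕ.^-*-assoc q 3 2 ⟩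
  q ^ 6                  ≡⟨ ℕ.^-*-assoc q 2 3 ⟨
  (q ^ 2) ^ 3            ∎)
  where
  open ℕ.≤-Reasoning
  expand : ∀ n → (8 * n) * ((8 * n) * ((8 * n) * 1)) ≡ 32 * (16 * (n * (n * n)))
  expand = solve-∀
  collect : ∀ n → n * (16 * (n * (n * n))) ≡ (4 * (n * n)) * ((4 * (n * n)) * 1)
  collect = solve-∀

free-bound : ∀ n q-1 x → .⦃ _ : NonZero n ⦄ → let q = suc q-1; M = (n * n) * (n * n) in
  4 * (n * n) ≤ q ^ 3 → q ^ 3 ≤ 32 * (n * n) → 8 * n ≤ q ^ 2 →
  M * q ^ 3 ≤ q ^ 4 * x + M * (n * n + q * (n + n)) →
  n ^ 10 ≤ 512 * x ^ 3
-- The constant 256 is relaxed to 512 = 8³, a perfect cube, so that its cube root is rational.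
free-bound n@(suc _) q-1 x lower upper 8n≤ count = ℕ.≤-trans n¹⁰≤ (ℕ.*-monoˡ-≤ (x ^ 3) (ℕ.m≤m+n 256 256))
  where
  open ℕ.≤-Reasoning
  q M : ℕ
  q = suc q-1
  M = (n * n) * (n * n)

  -- Each of the two loss terms is at most a quarter of the main term: 4n² ≤ q³ and 4q · 2n ≤ q³.
  -- Half of `M * q ^ 3` therefore survives.
  double-count : M * (2 * q ^ 3) + M * (2 * q ^ 3) ≤ (2 * (q * x)) * (2 * q ^ 3) + M * (2 * q ^ 3)
  double-count = begin
    M * (2 * q ^ 3) + M * (2 * q ^ 3)                      ≡⟨ e₁ M (q ^ 3) ⟩
    4 * (M * q ^ 3)                                        ≤⟨ ℕ.*-monoʳ-≤ 4 count ⟩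
    4 * (q ^ 4 * x + M * (n * n + q * (n + n)))            ≡⟨ e₂ q x M n ⟩
    (2 * (q * x)) * (2 * q ^ 3) + M * (4 * (n * n) + q * (8 * n))
      ≤⟨ ℕ.+-monoʳ-≤ ((2 * (q * x)) * (2 * q ^ 3))
           (ℕ.*-monoʳ-≤ M (ℕ.+-mono-≤ lower (ℕ.*-monoʳ-≤ q 8n≤))) ⟩
    (2 * (q * x)) * (2 * q ^ 3) + M * (q ^ 3 + q ^ 3)      ≡⟨ e₃ (q ^ 3) ((2 * (q * x)) * (2 * q ^ 3)) M ⟩
    (2 * (q * x)) * (2 * q ^ 3) + M * (2 * q ^ 3)          ∎
    where
    e₁ : ∀ a b → a * (2 * b) + a * (2 * b) ≡ 4 * (a * b)
    e₁ = solve-∀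
    e₂ : ∀ q x a n → 4 * (q * (q * (q * (q * 1))) * x + a * (n * n + q * (n + n))) ≡
         (2 * (q * x)) * (2 * (q * (q * (q * 1)))) + a * (4 * (n * n) + q * (8 * n))
    e₂ = solve-∀
    e₃ : ∀ b c a → c + a * (b + b) ≡ c + a * (2 * b)
    e₃ = solve-∀

  M≤2qx : M ≤ 2 * (q * x)
  M≤2qx = ℕ.*-cancelʳ-≤ _ _ (2 * q ^ 3) (ℕ.+-cancelʳ-≤ (M * (2 * q ^ 3)) _ _ double-count)

  n¹⁰≤ : n ^ 10 ≤ 256 * x ^ 3
  -- Cubing M ≤ 2qx replaces q³ by 32n², and n² cancels from n¹² ≤ 256x³n².
  n¹⁰≤ = ℕ.*-cancelʳ-≤ _ _ (n * n) (begin
    n ^ 10 * (n * n)                ≡⟨ cube-M n ⟩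
    M ^ 3                           ≤⟨ ℕ.^-monoˡ-≤ 3 M≤2qx ⟩
    (2 * (q * x)) ^ 3               ≡⟨ cube-2qx q x ⟩
    8 * x ^ 3 * q ^ 3               ≤⟨ ℕ.*-monoʳ-≤ (8 * x ^ 3) upper ⟩
    8 * x ^ 3 * (32 * (n * n))      ≡⟨ regroup (x ^ 3) (n * n) ⟩
    256 * x ^ 3 * (n * n)           ∎)
    where
    cube-M : ∀ n → n * (n * (n * (n * (n * (n * (n * (n * (n * (n * 1))))))))) * (n * n) ≡
      ((n * n) * (n * n)) * (((n * n) * (n * n)) * (((n * n) * (n * n)) * 1))
    cube-M = solve-∀
    cube-2qx : ∀ q x → (2 * (q * x)) * ((2 * (q * x)) * ((2 * (q * x)) * 1)) ≡
      8 * (x * (x * (x * 1))) * (q * (q * (q * 1)))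
    cube-2qx = solve-∀
    regroup : ∀ a b → 8 * a * (32 * b) ≡ 256 * a * b
    regroup = solve-∀

-- Transfer to the rational formulation.

-- Rewriting with this explicit fraction of denominator 1 lets rational order and arithmetic reduce
-- to those of integers.
fromℕ-normal : ∀ k → fromℕ k ≡ mkℚ (ℤ.+ k) 0 (Coprime.sym (Coprime.1-coprimeTo k))
fromℕ-normal k = ℚ.↥p/↧p≡p (mkℚ (ℤ.+ k) 0 (Coprime.sym (Coprime.1-coprimeTo k)))

fromℕ-mono-≤ : ∀ {k l} → k ≤ l → fromℕ k ℚ.≤ fromℕ l
fromℕ-mono-≤ {k} {l} k≤l rewrite fromℕ-normal k | fromℕ-normal l =
  *≤* (ℤ.*-monoʳ-≤-nonNeg (ℤ.+ 1) (ℤ.+≤+ k≤l))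

fromℕ-+ : ∀ k l → fromℕ (k + l) ≡ fromℕ k ℚ.+ fromℕ l
fromℕ-+ k l rewrite fromℕ-normal k | fromℕ-normal l =
  cong (ℚ._/ 1) (cong₂ ℤ._+_ (sym (ℤ.*-identityʳ (ℤ.+ k))) (sym (ℤ.*-identityʳ (ℤ.+ l))))

fromℕ-* : ∀ k l → fromℕ (k * l) ≡ fromℕ k ℚ.* fromℕ l
fromℕ-* k l rewrite fromℕ-normal k | fromℕ-normal l = cong (ℚ._/ 1) (ℤ.pos-* k l)

fromℕ-∸ : ∀ {k l} → l ≤ k → fromℕ k ℚ.- fromℕ l ≡ fromℕ (k ∸ l)
fromℕ-∸ {k} {l} l≤k = begin
  fromℕ k ℚ.- fromℕ l                        ≡⟨ cong (λ z → fromℕ z ℚ.- fromℕ l) (ℕ.m∸n+n≡m l≤k) ⟨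
  fromℕ (k ∸ l + l) ℚ.- fromℕ l              ≡⟨ cong (ℚ._- fromℕ l) (fromℕ-+ (k ∸ l) l) ⟩
  fromℕ (k ∸ l) ℚ.+ fromℕ l ℚ.- fromℕ l      ≡⟨ ℚ.+-assoc (fromℕ (k ∸ l)) _ _ ⟩
  fromℕ (k ∸ l) ℚ.+ (fromℕ l ℚ.- fromℕ l)    ≡⟨ cong (fromℕ (k ∸ l) ℚ.+_) (ℚ.+-inverseʳ (fromℕ l)) ⟩
  fromℕ (k ∸ l) ℚ.+ 0ℚ                       ≡⟨ ℚ.+-identityʳ _ ⟩
  fromℕ (k ∸ l)                              ∎
  where open ≡-Reasoning

fromℕ-cube : ∀ k → fromℕ (k ^ 3) ≡ cube (fromℕ k)
fromℕ-cube k = begin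
  fromℕ (k ^ 3)      ≡⟨ cong fromℕ (reassoc k) ⟩
  fromℕ (k * k * k)  ≡⟨ trans (fromℕ-* (k * k) k) (cong (ℚ._* fromℕ k) (fromℕ-* k k)) ⟩
  cube (fromℕ k)     ∎
  where
  open ≡-Reasoning
  reassoc : ∀ k → k * (k * (k * 1)) ≡ k * k * k
  reassoc = solve-∀

⅛ : ℚ
⅛ = ℤ.+ 1 ℚ./ 8

≤n⁴-⅛n^10/3 : ∀ n s → s ≤ n ^ 4 → n ^ 10 ≤ 512 * (n ^ 4 ∸ s) ^ 3 →
              s ≤n⁴- ⅛ ·n^10/3[n= n ]
≤n⁴-⅛n^10/3 n s s≤n⁴ bound = begin
  cube ⅛ ℚ.* fromℕ (n ^ 10)                  ≤⟨ ℚ.*-monoˡ-≤-nonNeg (cube ⅛) (fromℕ-mono-≤ bound) ⟩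
  cube ⅛ ℚ.* fromℕ (512 * d ^ 3)             ≡⟨ cong (cube ⅛ ℚ.*_) (fromℕ-* 512 (d ^ 3)) ⟩
  cube ⅛ ℚ.* (fromℕ 512 ℚ.* fromℕ (d ^ 3))   ≡⟨ ℚ.*-assoc (cube ⅛) (fromℕ 512) (fromℕ (d ^ 3)) ⟨
  -- The product `cube ⅛ ℚ.* fromℕ 512` evaluates to `1ℚ`.
  1ℚ ℚ.* fromℕ (d ^ 3)                       ≡⟨ ℚ.*-identityˡ (fromℕ (d ^ 3)) ⟩
  fromℕ (d ^ 3)                              ≡⟨ fromℕ-cube d ⟩
  cube (fromℕ d)                             ≡⟨ cong cube (fromℕ-∸ s≤n⁴) ⟨
  cube (fromℕ (n ^ 4) ℚ.- fromℕ s)           ∎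
  where
  open ℚ.≤-Reasoning
  d : ℕ
  d = n ^ 4 ∸ s

-- The bound for a colouring that attains the maximum.

theorem11 : Σ[ C ∈ ℚ ] Σ[ n₀ ∈ ℕ ] (0ℚ < C) ×
    (∀ n → n₀ ≤ n → max-scs (Sud n) ≤n⁴- C ·n^10/3[n= n ])
-- The constant is the cube root of 1/512 from `free-bound`; the threshold is that of `8n≤q²`.
theorem11 = ⅛ , 32 , toWitness {a? = 0ℚ ℚ.<? ⅛} _ , λ n 32≤n →
  let instance
        n≢0 : NonZero n
        n≢0 = ℕ.>-nonZero (ℕ.≤-trans (s≤s z≤n) 32≤n)
      (c , proper , scs≡max) , _ = max-scs-isGreatest (Sud n)
      open ColouredSudoku n (proj₂ (χ-isLeast (Sud n)) _ (LatinColouring.colourable n)) c proper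
      q-1 , 4n²≤q³ , q³≤32n² = ∃-scale n
      T , count = ∃-large-free q-1
      scs≤ = scs≤∣determining∣ (Sud n) c (∁ (free T)) (∁-free-determining T)
      -- Complementing turns the upper bound on `scs` into one on `∣ free T ∣`; truncated
      -- subtraction is undone because `∣ free T ∣` is at most the order.
      free≤ = ℕ.≤-trans (ℕ.≤-reflexive (sym (ℕ.m∸[m∸n]≡n (∣p∣≤n (free T)))))
        (ℕ.∸-monoʳ-≤ (order (Sud n)) (ℕ.≤-trans scs≤ (ℕ.≤-reflexive (∣∁p∣≡n∸∣p∣ (free T)))))
  in subst (_≤n⁴- ⅛ ·n^10/3[n= n ]) scs≡max
    (≤n⁴-⅛n^10/3 n (scs (Sud n) c)
      (subst (scs (Sud n) c ≤_) (order≡ n) (scs≤order (Sud n) c))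
      (ℕ.≤-trans
        (free-bound n q-1 ∣ free T ∣ 4n²≤q³ q³≤32n² (8n≤q² n (suc q-1) 32≤n 4n²≤q³) count)
        (ℕ.*-monoʳ-≤ 512 (ℕ.^-monoˡ-≤ 3
          (subst (λ k → ∣ free T ∣ ≤ k ∸ scs (Sud n) c) (order≡ n) free≤)))))
  where
  order≡ : ∀ n → (n * n) * (n * n) ≡ n * (n * (n * (n * 1)))
  order≡ = solve-∀
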